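{- Let $s,t,q,N$ be integers with $0\le s<q$, $1\le t<q$, $N\ge0$, $t\nmid q$ and $\gcd(t,q)=g>1$. Put $\tilde t=t/g$, $\tilde q=q/g$, and write $s=\overline sg+s_g$ ($0\le s_g<g$), $\overline s=\overline{\overline s}\tilde t+\hat{\hat s}$ ($0\le\hat{\hat s}<\tilde t$), $\tilde q=\overline{\overline q}\tilde t+\hat{\hat q}$ ($1\le\hat{\hat q}<\tilde t$). Let $S^-(s,t,q,N)=\sum_{k=0}^N\lfloor(s-kt)/q\rfloor$, $M=-\lfloor(s-Nt)/q\rfloor$, $x_M=(s+(M-1)q)/t$, $S=-\lfloor q/t\rfloor\frac{(M-1)M}2-M(N-\lfloor x_M\rfloor)$, $H=\{k\in\mathbb N:(\hat{\hat s}+k\hat{\hat q})\bmod\tilde t<\hat{\hat q}\}$, $J=H\cap\{0,\dots,\tilde t-1\}=\{j_0<\dots<j_{\hat{\hat q}-1}\}$, $S_K=\sum_{k\in K}k$. Then: (a) if $j_0\ge M$, $S^-(s,t,q,N)=S$; (b.1) if $j_0<M\le j_{\hat{\hat q}-1}$, $S^-(s,t,q,N)=S-S_K$ with $K=H\cap\{0,\dots,M-1\}$; (b.2) if $j_{\hat{\hat q}-1}<M$ and $j_0+\tilde t\ge M$, $S^-(s,t,q,N)=S-S_J$; (b.3) if $j_{\hat{\hat q}-1}<M$ and $j_0+\tilde t<M$, with $u=\lfloor(M-1)/\tilde t\rfloor$ and $K=H\cap\{u\tilde t,\dots,M-1\}$, $S^-(s,t,q,N)=S-uS_J-\hat{\hat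 q}\,\tilde t\frac{(u-1)u}2-S_K$.
   Context: Here $r\bmod\tilde t$ denotes the representative of $r$ in $\{0,\dots,\tilde t-1\}$. -}

module Defs where

open import Data.Fin.Base as Fin using (Fin; fromℕ<)
open import Data.Integer.Base using (ℤ; +_; -_; _+_; _-_; _*_; _/ℕ_; _≤_; ∣_∣; 0ℤ; 1ℤ)
open import Data.Integer.Properties using (_≤?_)
open import Data.List.Base using (List; filter; foldr; map; tabulate; upTo)
open import Data.Nat.Base as ℕ using (ℕ; suc; NonZero; ≢-nonZero; ≢-nonZero⁻¹; >-nonZero⁻¹)
open import Data.Nat.Divisibility using (_∣_; _∤_; *-monoˡ-∣; m%n≡0⇒n∣m)
import Data.Nat.DivMod as ℕ
open import Data.Nat.GCD using (gcd; gcd[m,n]∣m; gcd[m,n]∣n; gcd[m,n]≢0; m/gcd[m,n]≢0)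
open import Data.Nat.ListAction using (sum)
import Data.Nat.Properties as ℕ
open import Data.Product.Base using (_×_)
open import Data.Rational.Base as ℚ using (ℚ; floor)
open import Data.Sum.Base using (inj₁)
open import Relation.Binary.PropositionalEquality using (_≡_; subst₂)
open import Relation.Nullary.Decidable using (Dec; _×-dec_)

S⁻ : (s t q N : ℕ) .{{_ : NonZero q}} → ℤ
S⁻ s t q N = foldr _+_ 0ℤ (map (λ k → ⌊ (+ s - + k * + t) ℚ./ q ⌋) (upTo (suc N)))

∑ : List ℕ → ℤ
∑ K = + sum K

module Setting (s t q N : ℕ) .{{_ : NonZero t}} .{{_ : NonZero q}} (t∤q : t ∤ q) where

  g : ℕ
  g = gcd t q

  instance
    g≢0 : NonZero g
    g≢0 = ≢-nonZero (gcd[m,n]≢0 t q (inj₁ (≢-nonZero⁻¹ t)))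

  t̃ q̃ : ℕ
  t̃ = t ℕ./ g
  q̃ = q ℕ./ g

  instance
    t̃≢0 : NonZero t̃
    t̃≢0 = ≢-nonZero (m/gcd[m,n]≢0 t q)

  -- s̄ and ŝ are the quotient s / g and the remainder of s̄ modulo t̃;
  -- the remaining parts of the two decompositions of s are never used.
  s̄ ŝ q̂ : ℕ
  s̄ = s ℕ./ g
  ŝ = s̄ ℕ.% t̃
  q̂ = q̃ ℕ.% t̃

  instance
    q̂≢0 : NonZero q̂
    q̂≢0 = ≢-nonZero λ q̂≡0 → t∤q
      (subst₂ _∣_ (ℕ.m/n*n≡m (gcd[m,n]∣m t q)) (ℕ.m/n*n≡m (gcd[m,n]∣n t q))
        (*-monoˡ-∣ g (m%n≡0⇒n∣m q̃ t̃ q̂≡0)))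

  M : ℤ
  M = - ⌊ (+ s - + N * + t) ℚ./ q ⌋

  x-M : ℚ
  x-M = (+ s + (M - 1ℤ) * + q) ℚ./ t

  -- The division by 2 is exact.
  S : ℤ
  S = - (⌊ + q ℚ./ t ⌋ * (((M - 1ℤ) * M) /ℕ 2)) - M * (+ N - ⌊ x-M ⌋)

  H : ℕ → Set
  H k = (ŝ ℕ.+ k ℕ.* q̂) ℕ.% t̃ ℕ.< q̂

  H? : (k : ℕ) → Dec (H k)
  H? k = (ŝ ℕ.+ k ℕ.* q̂) ℕ.% t̃ ℕ.<? q̂

  -- H ∩ {a,…,b} in increasing order; a natural number k ≤ b satisfies k ≤ ∣ b ∣.
  H∩[_⋯_] : ℤ → ℤ → List ℕ
  H∩[ a ⋯ b ] = filter (λ k → (a ≤? + k) ×-dec (+ k ≤? b) ×-dec H? k) (upTo (suc ∣ b ∣))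

  J : List ℕ
  J = H∩[ 0ℤ ⋯ + t̃ - 1ℤ ]

  -- J = {j 0 < … < j (q̂ - 1)}
  EnumeratesJ : (Fin q̂ → ℕ) → Set
  EnumeratesJ j = (∀ {i k} → i Fin.< k → j i ℕ.< j k) × J ≡ tabulate j

  first last : Fin q̂
  first = fromℕ< (>-nonZero⁻¹ q̂)
  last  = fromℕ< (ℕ.≤-reflexive (ℕ.suc-pred q̂))

  u : ℤ
  u = ⌊ (M - 1ℤ) ℚ./ t̃ ⌋

{-# OPTIONS --safe #-}
module Submission where

-- Counting lattice points by rows instead of columns gives S⁻ = − Σ_{m<M} (N − F m) with
-- F m = ⌊(s + m q)/t⌋. Dividing by g, F m = ⌊(s̄ + m q̃)/t̃⌋, so F (m + 1) − F m is ⌊q/t⌋ plus the carry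
-- of the addition of q̃ modulo t̃, which is 1 exactly if m + 1 ∈ H. Summation by parts turns this into
-- S⁻ = S − Σ_{k ∈ H, k < M} k. The four cases evaluate the last sum using that H is t̃-periodic and
-- that J has q̂ elements.

open import Defs
open import Data.Bool.Base using (true; false; if_then_else_)
open import Data.Fin.Base as Fin using (Fin)
import Data.Fin.Properties as Fin
open import Data.Integer.Base using (ℤ; +_; -_; _+_; _-_; _*_; _/ℕ_; _≤_; _≥_; _<_; 0ℤ; 1ℤ)
import Data.Integer.Base as ℤ
import Data.Integer.DivMod as ℤ
import Data.Integer.GCD as ℤ
import Data.Integer.Properties as ℤ
import Data.Integer.Tactic.RingSolver as ℤ-Ring
open import Data.List.Base using (List; []; _∷_; [_]; _++_; applyUpTo; filter; foldr; length; lookup; map; tabulate; upTo)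
open import Data.List.Membership.Propositional.Properties using (∈-filter⁺; ∈-lookup; ∈-tabulate⁻; ∈-upTo⁺)
open import Data.List.Membership.Propositional using (_∈_)
open import Data.List.Properties using (filter-++; length-++; map-upTo; tabulate-lookup; upTo-∷ʳ)
open import Data.List.Relation.Unary.All as All using ()
open import Data.List.Relation.Unary.AllPairs using (AllPairs; _∷_)
import Data.List.Relation.Unary.AllPairs.Properties as AllPairs
open import Data.Nat.Base as ℕ using (ℕ; zero; suc; NonZero; ≢-nonZero⁻¹)
open import Data.Nat.Divisibility using (_∤_; divides; ∣n⇒∣m*n)
import Data.Nat.DivMod as ℕ
open import Data.Nat.GCD using (gcd; gcd[m,n]∣m; gcd[m,n]∣n; gcd[m,n]≢0)
open import Data.Nat.ListAction using (sum)
open import Data.Nat.ListAction.Properties using (sum-++)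
import Data.Nat.Properties as ℕ
import Data.Nat.Tactic.RingSolver as ℕ-Ring
open import Data.Product.Base using (_×_; _,_; proj₁; proj₂; ∃-syntax)
open import Data.Rational.Base as ℚ using (floor; ↥_; ↧_)
import Data.Rational.Properties as ℚ
open import Data.Sum.Base using (_⊎_; inj₁; inj₂)
open import Function.Base using (id; _∘_)
open import Relation.Binary.PropositionalEquality using (_≡_; refl; sym; trans; cong; cong₂; subst; module ≡-Reasoning)
open import Relation.Nullary using (Dec; yes; no; does; _because_; ofʸ; ofⁿ; ¬_; contradiction)
open import Relation.Nullary.Decidable using (_×-dec_)
open import Relation.Unary using (Pred; Decidable)

-- Finite sums

∑< : ℕ → (ℕ → ℕ) → ℕ
∑< zero    f = 0
∑< (suc n) f = ∑< n f ℕ.+ f n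

∑<-cong : ∀ n {f g : ℕ → ℕ} → (∀ k → k ℕ.< n → f k ≡ g k) → ∑< n f ≡ ∑< n g
∑<-cong zero    eq = refl
∑<-cong (suc n) eq = cong₂ ℕ._+_ (∑<-cong n λ k k<n → eq k (ℕ.m<n⇒m<1+n k<n)) (eq n (ℕ.n<1+n n))

∑<-zero : ∀ n {f : ℕ → ℕ} → (∀ k → k ℕ.< n → f k ≡ 0) → ∑< n f ≡ 0
∑<-zero zero    eq = refl
∑<-zero (suc n) eq = cong₂ ℕ._+_ (∑<-zero n λ k k<n → eq k (ℕ.m<n⇒m<1+n k<n)) (eq n (ℕ.n<1+n n))

∑<-split : ∀ m n (f : ℕ → ℕ) → ∑< (m ℕ.+ n) f ≡ ∑< m f ℕ.+ ∑< n (λ k → f (m ℕ.+ k))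
∑<-split m zero    f rewrite ℕ.+-identityʳ m = sym (ℕ.+-identityʳ _)
∑<-split m (suc n) f rewrite ℕ.+-suc m n | ∑<-split m n f = ℕ.+-assoc (∑< m f) _ _

∑<-truncate : ∀ {m n} {f : ℕ → ℕ} → m ℕ.≤ n → (∀ k → m ℕ.≤ k → k ℕ.< n → f k ≡ 0) → ∑< n f ≡ ∑< m f
∑<-truncate {m} {n} {f} m≤n f≡0 with ℕ.m≤n⇒∃[o]m+o≡n m≤n
... | o , refl = begin
  ∑< (m ℕ.+ o) f                          ≡⟨ ∑<-split m o f ⟩
  ∑< m f ℕ.+ ∑< o (λ k → f (m ℕ.+ k))     ≡⟨ cong (∑< m f ℕ.+_) (∑<-zero o λ k k<o → f≡0 _ (ℕ.m≤m+n m k) (ℕ.+-monoʳ-< m k<o)) ⟩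
  ∑< m f ℕ.+ 0                            ≡⟨ ℕ.+-identityʳ _ ⟩
  ∑< m f                                  ∎
  where open ≡-Reasoning

-- Evaluates a block of a weighted sum that starts at `c`: the offset multiplies the plain sum of
-- the block.
∑<-affine : ∀ c n (f : ℕ → ℕ) → ∑< n (λ k → (c ℕ.+ k) ℕ.* f k) ≡ c ℕ.* ∑< n f ℕ.+ ∑< n (λ k → k ℕ.* f k)
∑<-affine c zero    f = cong (ℕ._+ 0) (sym (ℕ.*-zeroʳ c))
∑<-affine c (suc n) f rewrite ∑<-affine c n f = lemma c n (∑< n f) (f n) _
  where
  lemma : ∀ c n a b d → c ℕ.* a ℕ.+ d ℕ.+ (c ℕ.+ n) ℕ.* b ≡ c ℕ.* (a ℕ.+ b) ℕ.+ (d ℕ.+ n ℕ.* b)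
  lemma = ℕ-Ring.solve-∀

gauss : ∀ n → ∑< (suc n) id ℕ.* 2 ≡ n ℕ.* suc n
gauss zero    = refl
gauss (suc n) = begin
  (∑< (suc n) id ℕ.+ suc n) ℕ.* 2        ≡⟨ ℕ.*-distribʳ-+ 2 (∑< (suc n) id) (suc n) ⟩
  ∑< (suc n) id ℕ.* 2 ℕ.+ suc n ℕ.* 2    ≡⟨ cong (ℕ._+ suc n ℕ.* 2) (gauss n) ⟩
  n ℕ.* suc n ℕ.+ suc n ℕ.* 2            ≡⟨ lemma n ⟩
  suc n ℕ.* suc (suc n)                  ∎
  where
  open ≡-Reasoning
  lemma : ∀ n → n ℕ.* suc n ℕ.+ suc n ℕ.* 2 ≡ suc n ℕ.* suc (suc n)
  lemma = ℕ-Ring.solve-∀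

-- Turns the quotients by 2 in the formulas into sums over naturals. At `n = 0` the factor -1 meets
-- a factor 0, so both sides vanish.
[n-1]n/2≡∑< : ∀ n → ((+ n - 1ℤ) * + n) /ℕ 2 ≡ + ∑< n id
[n-1]n/2≡∑< zero    = refl
[n-1]n/2≡∑< (suc n) = begin
  (+ n * + suc n) /ℕ 2               ≡⟨ cong (_/ℕ 2) (ℤ.pos-* n (suc n)) ⟨
  + (n ℕ.* suc n ℕ./ 2)              ≡⟨ cong (λ m → + (m ℕ./ 2)) (gauss n) ⟨
  + (∑< (suc n) id ℕ.* 2 ℕ./ 2)      ≡⟨ cong +_ (ℕ.m*n/n≡m (∑< (suc n) id) 2) ⟩
  + ∑< (suc n) id                    ∎
  where open ≡-Reasoning

foldr-+-neg : ∀ n {f : ℕ → ℤ} {a : ℕ → ℕ} → (∀ k → f k ≡ - + a k) → foldr _+_ 0ℤ (map f (upTo n)) ≡ - + ∑< n a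
foldr-+-neg n {f} eq rewrite map-upTo f n = go n eq
  where
  open ≡-Reasoning
  go : ∀ n {f : ℕ → ℤ} {a : ℕ → ℕ} → (∀ k → f k ≡ - + a k) → foldr _+_ 0ℤ (applyUpTo f n) ≡ - + ∑< n a
  go zero            eq = refl
  go (suc n) {f} {a} eq = begin
    f 0 + foldr _+_ 0ℤ (applyUpTo (f ∘ suc) n)  ≡⟨ cong₂ _+_ (eq 0) (go n (eq ∘ suc)) ⟩
    - + a 0 + - + ∑< n (a ∘ suc)                ≡⟨ ℤ.neg-distrib-+ (+ a 0) _ ⟨
    -- `foldr` peels terms off the front while `∑<` peels them off the end; splitting after one term
    -- reconciles the two.
    - + (a 0 ℕ.+ ∑< n (a ∘ suc))                ≡⟨ cong (-_ ∘ +_) (∑<-split 1 n a) ⟨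
    - + ∑< (suc n) a                            ∎

-- Indicators of decidable sets

⟦_⟧ : ∀ {p} {P : Set p} → Dec P → ℕ
⟦ P? ⟧ = if does P? then 1 else 0

⟦⟧-yes : ∀ {p} {P : Set p} (P? : Dec P) → P → ⟦ P? ⟧ ≡ 1
⟦⟧-yes (true  because _)       p = refl
⟦⟧-yes (false because ofⁿ ¬p) p = contradiction p ¬p

⟦⟧-no : ∀ {p} {P : Set p} (P? : Dec P) → ¬ P → ⟦ P? ⟧ ≡ 0
⟦⟧-no (true  because ofʸ p) ¬p = contradiction p ¬p
⟦⟧-no (false because _)     ¬p = refl

⟦⟧-cong : ∀ {p q} {P : Set p} {Q : Set q} (P? : Dec P) (Q? : Dec Q) → (P → Q) → (Q → P) → ⟦ P? ⟧ ≡ ⟦ Q? ⟧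
⟦⟧-cong (yes p) Q? to from = sym (⟦⟧-yes Q? (to p))
⟦⟧-cong (no ¬p) Q? to from = sym (⟦⟧-no Q? (¬p ∘ from))

module _ {p} {P : Pred ℕ p} (P? : Decidable P) where

  filter-upTo-suc : ∀ n → filter P? (upTo (suc n)) ≡ filter P? (upTo n) ++ filter P? [ n ]
  filter-upTo-suc n = trans (cong (filter P?) (sym (upTo-∷ʳ n))) (filter-++ P? (upTo n) [ n ])

  length-filter-upTo : ∀ n → length (filter P? (upTo n)) ≡ ∑< n (λ k → ⟦ P? k ⟧)
  length-filter-upTo zero    = refl
  length-filter-upTo (suc n) = begin
    length (filter P? (upTo (suc n)))                            ≡⟨ cong length (filter-upTo-suc n) ⟩
    length (filter P? (upTo n) ++ filter P? [ n ])               ≡⟨ length-++ (filter P? (upTo n)) ⟩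
    length (filter P? (upTo n)) ℕ.+ length (filter P? [ n ])     ≡⟨ cong₂ ℕ._+_ (length-filter-upTo n) last-term ⟩
    ∑< n (λ k → ⟦ P? k ⟧) ℕ.+ ⟦ P? n ⟧                           ∎
    where
    open ≡-Reasoning
    last-term : length (filter P? [ n ]) ≡ ⟦ P? n ⟧
    last-term with does (P? n)
    ... | true  = refl
    ... | false = refl

  sum-filter-upTo : ∀ n → sum (filter P? (upTo n)) ≡ ∑< n (λ k → k ℕ.* ⟦ P? k ⟧)
  sum-filter-upTo zero    = refl
  sum-filter-upTo (suc n) = begin
    sum (filter P? (upTo (suc n)))                         ≡⟨ cong sum (filter-upTo-suc n) ⟩
    sum (filter P? (upTo n) ++ filter P? [ n ])            ≡⟨ sum-++ (filter P? (upTo n)) _ ⟩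
    sum (filter P? (upTo n)) ℕ.+ sum (filter P? [ n ])     ≡⟨ cong₂ ℕ._+_ (sum-filter-upTo n) last-term ⟩
    ∑< n (λ k → k ℕ.* ⟦ P? k ⟧) ℕ.+ n ℕ.* ⟦ P? n ⟧         ∎
    where
    open ≡-Reasoning
    last-term : sum (filter P? [ n ]) ≡ n ℕ.* ⟦ P? n ⟧
    last-term with does (P? n)
    ... | true  = trans (ℕ.+-identityʳ n) (sym (ℕ.*-identityʳ n))
    ... | false = sym (ℕ.*-zeroʳ n)

-- The list's own `lookup` is the enumeration. The length is a separate `n` so that the index type
-- can be `Fin q̂`.
increasing-tabulate : ∀ {xs : List ℕ} {n} → AllPairs ℕ._<_ xs → length xs ≡ n →
  ∃[ j ] (∀ {i k : Fin n} → i Fin.< k → j i ℕ.< j k) × xs ≡ tabulate j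
increasing-tabulate {xs} xs↗ refl = lookup xs , lookup-mono xs↗ _ _ , sym (tabulate-lookup xs)
  where
  lookup-mono : ∀ {xs} → AllPairs ℕ._<_ xs → ∀ i k → i Fin.< k → lookup xs i ℕ.< lookup xs k
  lookup-mono {x ∷ xs} (x< ∷ _) Fin.zero    (Fin.suc k) _   = All.lookup x< (∈-lookup k)
  lookup-mono {x ∷ xs} (_ ∷ xs↗) (Fin.suc i) (Fin.suc k) i<k = lookup-mono xs↗ i k (ℕ.s<s⁻¹ i<k)

-- Floors and division with remainder

i<suc[j]⇒i≤j : ∀ {i j} → i < ℤ.suc j → i ≤ j
i<suc[j]⇒i≤j {i} {j} i<1+j = subst (i ≤_) (ℤ.pred-suc j) (ℤ.i<j⇒i≤pred[j] i<1+j)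

floor-unique-↥↧ : ∀ p z → z * ↧ p ≤ ↥ p → ↥ p < ℤ.suc z * ↧ p → floor p ≡ z
floor-unique-↥↧ p@record{} z lower upper = ℤ.≤-antisym
  (i<suc[j]⇒i≤j (ℤ.*-cancelʳ-<-nonNeg (↧ p) (ℤ.≤-<-trans (ℤ.[n/d]*d≤n (↥ p) (↧ p)) upper)))
  (i<suc[j]⇒i≤j (ℤ.*-cancelʳ-<-nonNeg (↧ p) (ℤ.≤-<-trans lower
    -- `floor` unfolds to integer division by `↧ p`; the upper remainder bound is available for its
    -- `/ℕ` form.
    (subst (λ x → ↥ p < ℤ.suc x * ↧ p) (sym (ℤ.div-pos-is-/ℕ (↥ p) (ℚ.↧ₙ p))) (ℤ.n<s[n/ℕd]*d (↥ p) (ℚ.↧ₙ p))))))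

-- The fraction `i ℚ./ n` is stored in lowest terms. Multiplying by the gcd `d` restores `i` and
-- `n`, so both floor inequalities are shown after scaling by `d`, which is then cancelled.
floor-unique : ∀ i n .{{_ : NonZero n}} z r → r ℕ.< n → i ≡ + r + z * + n → floor (i ℚ./ n) ≡ z
floor-unique i n z r r<n i≡ = floor-unique-↥↧ p z
  (ℤ.*-cancelʳ-≤-pos (z * ↧ p) (↥ p) d lower)
  (ℤ.*-cancelʳ-<-nonNeg d upper)
  where
  p = i ℚ./ n
  d = ℤ.gcd i (+ n)
  instance
    d>0 : ℤ.Positive d
    d>0 = ℤ.positive (ℤ.+<+ (ℕ.n≢0⇒n>0 (gcd[m,n]≢0 ℤ.∣ i ∣ n (inj₂ (≢-nonZero⁻¹ n)))))
    d≥0 : ℤ.NonNegative d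
    d≥0 = _
  scaled : ∀ x → x * ↧ p * d ≡ x * + n
  scaled x = trans (ℤ.*-assoc x (↧ p) d) (cong (x *_) (ℚ.↧-/ i n))
  open ℤ.≤-Reasoning
  lower : z * ↧ p * d ≤ ↥ p * d
  lower = begin
    z * ↧ p * d       ≡⟨ scaled z ⟩
    z * + n           ≤⟨ ℤ.i≤j+i (z * + n) (+ r) ⟩
    + r + z * + n     ≡⟨ i≡ ⟨
    i                 ≡⟨ ℚ.↥-/ i n ⟨
    ↥ p * d           ∎
  upper : ↥ p * d < ℤ.suc z * ↧ p * d
  upper = begin-strict
    ↥ p * d               ≡⟨ ℚ.↥-/ i n ⟩
    i                     ≡⟨ i≡ ⟩
    + r + z * + n         <⟨ ℤ.+-monoˡ-< (z * + n) (ℤ.+<+ r<n) ⟩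
    + n + z * + n         ≡⟨ ℤ.suc-* z (+ n) ⟨
    ℤ.suc z * + n         ≡⟨ scaled (ℤ.suc z) ⟨
    ℤ.suc z * ↧ p * d     ∎

floor-+ : ∀ m n .{{_ : NonZero n}} → floor (+ m ℚ./ n) ≡ + (m ℕ./ n)
floor-+ m n = floor-unique (+ m) n _ _ (ℤ.n%ℕd<d (+ m) n) (ℤ.a≡a%ℕn+[a/ℕn]*n (+ m) n)

-- For s < q, −⌊(s − k)/q⌋ is the ceiling of (k − s)/q, here without subtraction.
floor-neg : ∀ s c k q .{{_ : NonZero q}} → s ℕ.+ suc c ≡ q → floor ((+ s - + k) ℚ./ q) ≡ - + ((k ℕ.+ c) ℕ./ q)
floor-neg s c k q s+c+1≡q with ℕ.m≤n⇒∃[o]m+o≡n (ℕ.m%n<n (k ℕ.+ c) q)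
-- The remainder is reflected: s - k = (q - 1) - (k + c), so dividing k + c with remainder `r`
-- leaves `r′` = q - 1 - r here.
... | r′ , r+r′+1≡q = floor-unique (+ s - + k) q (- + a) r′
  (subst (r′ ℕ.<_) r+r′+1≡q (ℕ.s≤s (ℕ.m≤n+m r′ r))) (lemma (+ s) (+ c) (+ k) (+ q) (+ a) (+ r) (+ r′)
    (cong +_ s+c+1≡q) (cong +_ r+r′+1≡q)
    (ℤ.a≡a%ℕn+[a/ℕn]*n (+ (k ℕ.+ c)) q))
  where
  a r : ℕ
  a = (k ℕ.+ c) ℕ./ q
  r = (k ℕ.+ c) ℕ.% q
  open ≡-Reasoning
  lemma : ∀ s c k q a r r′ → s + (1ℤ + c) ≡ q → 1ℤ + (r + r′) ≡ q → k + c ≡ r + a * q → s - k ≡ r′ + - a * q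
  lemma s c k q a r r′ s+c+1≡q r+r′+1≡q k+c≡ = begin
    s - k                                                        ≡⟨ id₁ s k c r ⟩
    (s + (1ℤ + c)) - (1ℤ + r) - (k + c) + r                      ≡⟨ cong₂ (λ x y → x - (1ℤ + r) - y + r) (trans s+c+1≡q (sym r+r′+1≡q)) k+c≡ ⟩
    (1ℤ + (r + r′)) - (1ℤ + r) - (r + a * q) + r                 ≡⟨ id₂ r r′ a q ⟩
    r′ + - a * q                                                 ∎
    where
    id₁ : ∀ s k c r → s - k ≡ (s + (1ℤ + c)) - (1ℤ + r) - (k + c) + r
    id₁ = ℤ-Ring.solve-∀
    id₂ : ∀ r r′ a q → (1ℤ + (r + r′)) - (1ℤ + r) - (r + a * q) + r ≡ r′ + - a * q
    id₂ = ℤ-Ring.solve-∀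

/%-unique : ∀ {m} d .{{_ : NonZero d}} r k → r ℕ.< d → m ≡ r ℕ.+ k ℕ.* d → m ℕ./ d ≡ k × m ℕ.% d ≡ r
/%-unique d r k r<d refl = quotient , trans (ℕ.[m+kn]%n≡m%n r k d) (ℕ.m<n⇒m%n≡m r<d)
  where
  open ≡-Reasoning
  quotient : (r ℕ.+ k ℕ.* d) ℕ./ d ≡ k
  quotient = begin
    (r ℕ.+ k ℕ.* d) ℕ./ d         ≡⟨ ℕ.+-distrib-/-∣ʳ r (divides k refl) ⟩
    r ℕ./ d ℕ.+ k ℕ.* d ℕ./ d     ≡⟨ cong₂ ℕ._+_ (ℕ.m<n⇒m/n≡0 r<d) (ℕ.m*n/n≡m k d) ⟩
    k                             ∎

+-divide : ∀ a b d .{{_ : NonZero d}} →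
  a ℕ.+ b ≡ (a ℕ.% d ℕ.+ b ℕ.% d) ℕ.+ (a ℕ./ d ℕ.+ b ℕ./ d) ℕ.* d
+-divide a b d = trans
  (cong₂ ℕ._+_ (ℕ.m≡m%n+[m/n]*n a d) (ℕ.m≡m%n+[m/n]*n b d))
  (rearrange (a ℕ.% d) (b ℕ.% d) (a ℕ./ d) (b ℕ./ d) d)
  where
  rearrange : ∀ r r′ x y d → (r ℕ.+ x ℕ.* d) ℕ.+ (r′ ℕ.+ y ℕ.* d) ≡ (r ℕ.+ r′) ℕ.+ (x ℕ.+ y) ℕ.* d
  rearrange = ℕ-Ring.solve-∀

-- Without a carry the remainder of the sum is a % d + b % d, which is at least b % d. With a carry
-- it is smaller by `d`, and a % d < d puts it below b % d. So comparing with b % d detects the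
-- carry.
/-+-carry : ∀ a b d .{{_ : NonZero d}} →
  (a ℕ.+ b) ℕ./ d ≡ a ℕ./ d ℕ.+ b ℕ./ d ℕ.+ ⟦ (a ℕ.+ b) ℕ.% d ℕ.<? b ℕ.% d ⟧
/-+-carry a b d with a ℕ.% d ℕ.+ b ℕ.% d ℕ.<? d
... | yes r<d = trans (proj₁ e) (sym (trans (cong (x ℕ.+_) (⟦⟧-no (_ ℕ.<? _) no-carry)) (ℕ.+-identityʳ x)))
  where
  x = a ℕ./ d ℕ.+ b ℕ./ d
  e = /%-unique {a ℕ.+ b} d (a ℕ.% d ℕ.+ b ℕ.% d) x r<d (+-divide a b d)
  no-carry : (a ℕ.+ b) ℕ.% d ℕ.≮ b ℕ.% d
  no-carry rewrite proj₂ e = ℕ.≤⇒≯ (ℕ.m≤n+m (b ℕ.% d) (a ℕ.% d))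
... | no r≮d with ℕ.m≤n⇒∃[o]m+o≡n (ℕ.≮⇒≥ r≮d)
...   | o , d+o≡r = trans (proj₁ e) (cong (x ℕ.+_) (sym (⟦⟧-yes (_ ℕ.<? _) carry)))
  where
  x = a ℕ./ d ℕ.+ b ℕ./ d
  o<b%d : o ℕ.< b ℕ.% d
  o<b%d = ℕ.+-cancelˡ-< d _ _ (subst (ℕ._< d ℕ.+ b ℕ.% d) (sym d+o≡r) (ℕ.+-monoˡ-< (b ℕ.% d) (ℕ.m%n<n a d)))
  absorb : ∀ o k d → (d ℕ.+ o) ℕ.+ k ℕ.* d ≡ o ℕ.+ (k ℕ.+ 1) ℕ.* d
  absorb = ℕ-Ring.solve-∀
  e = /%-unique {a ℕ.+ b} d o (x ℕ.+ 1) (ℕ.<-trans o<b%d (ℕ.m%n<n b d))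
    (trans (+-divide a b d) (trans (cong (ℕ._+ x ℕ.* d) (sym d+o≡r)) (absorb o x d)))
  carry : (a ℕ.+ b) ℕ.% d ℕ.< b ℕ.% d
  carry = subst (ℕ._< b ℕ.% d) (sym (proj₂ e)) o<b%d

-- Connects `H`, phrased with the reduced `ŝ` and `q̂`, to the unreduced `s̄` and `q̃` that occur in
-- `F`.
%-affine : ∀ a b k d .{{_ : NonZero d}} → (a ℕ.% d ℕ.+ k ℕ.* (b ℕ.% d)) ℕ.% d ≡ (a ℕ.+ k ℕ.* b) ℕ.% d
%-affine a b k d = begin
  (a ℕ.% d ℕ.+ k ℕ.* (b ℕ.% d)) ℕ.% d                                                 ≡⟨ ℕ.[m+kn]%n≡m%n _ (a ℕ./ d ℕ.+ k ℕ.* (b ℕ./ d)) d ⟨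
  (a ℕ.% d ℕ.+ k ℕ.* (b ℕ.% d) ℕ.+ (a ℕ./ d ℕ.+ k ℕ.* (b ℕ./ d)) ℕ.* d) ℕ.% d         ≡⟨ cong (ℕ._% d) (rearrange (a ℕ.% d) (b ℕ.% d) (a ℕ./ d) (b ℕ./ d) k d) ⟩
  ((a ℕ.% d ℕ.+ a ℕ./ d ℕ.* d) ℕ.+ k ℕ.* (b ℕ.% d ℕ.+ b ℕ./ d ℕ.* d)) ℕ.% d           ≡⟨ cong₂ (λ x y → (x ℕ.+ k ℕ.* y) ℕ.% d) (ℕ.m≡m%n+[m/n]*n a d) (ℕ.m≡m%n+[m/n]*n b d) ⟨
  (a ℕ.+ k ℕ.* b) ℕ.% d                                                               ∎
  where
  open ≡-Reasoning
  rearrange : ∀ r r′ x y k d → r ℕ.+ k ℕ.* r′ ℕ.+ (x ℕ.+ k ℕ.* y) ℕ.* d ≡ (r ℕ.+ x ℕ.* d) ℕ.+ k ℕ.* (r′ ℕ.+ y ℕ.* d)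
  rearrange = ℕ-Ring.solve-∀

-- In the rectangle 1 ≤ k ≤ N, 0 ≤ m < A N, the point (k , m) is counted by the first sum (column by
-- column) if k t > s + m q, and by the second sum (row by row) otherwise.
∑⌈⌉+∑⌊⌋ : ∀ s c t q .{{_ : NonZero t}} .{{_ : NonZero q}} → s ℕ.+ suc c ≡ q → t ℕ.≤ q →
  ∀ N → let A = λ k → (k ℕ.* t ℕ.+ c) ℕ./ q in
  ∑< (suc N) A ℕ.+ ∑< (A N) (λ m → (s ℕ.+ m ℕ.* q) ℕ./ t) ≡ N ℕ.* A N
∑⌈⌉+∑⌊⌋ s c t q s+c+1≡q t≤q = go
  where
  open ≡-Reasoning
  A F : ℕ → ℕ
  A k = (k ℕ.* t ℕ.+ c) ℕ./ q
  F m = (s ℕ.+ m ℕ.* q) ℕ./ t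
  c<q : c ℕ.< q
  c<q = subst (c ℕ.<_) s+c+1≡q (ℕ.m≤n+m (suc c) s)
  -- As `t ≤ q`, the ceiling `A` rises by at most one. When it rises, N t ≤ s + A N q < (N + 1) t,
  -- so the row that enters has floor `N`.
  step : ∀ N → A (suc N) ≡ A N ⊎ (A (suc N) ≡ suc (A N) × F (A N) ≡ N)
  step N with (N ℕ.* t ℕ.+ c) ℕ.% q ℕ.+ t ℕ.<? q
  ... | yes r+t<q = inj₁ (proj₁ (/%-unique q _ (A N) r+t<q (begin
    t ℕ.+ N ℕ.* t ℕ.+ c                                     ≡⟨ id₁ t (N ℕ.* t) c ⟩
    t ℕ.+ (N ℕ.* t ℕ.+ c)                                   ≡⟨ cong (t ℕ.+_) (ℕ.m≡m%n+[m/n]*n (N ℕ.* t ℕ.+ c) q) ⟩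
    t ℕ.+ ((N ℕ.* t ℕ.+ c) ℕ.% q ℕ.+ A N ℕ.* q)             ≡⟨ id₂ t ((N ℕ.* t ℕ.+ c) ℕ.% q) (A N ℕ.* q) ⟩
    ((N ℕ.* t ℕ.+ c) ℕ.% q ℕ.+ t) ℕ.+ A N ℕ.* q             ∎)))
    where
    id₁ : ∀ x y z → x ℕ.+ y ℕ.+ z ≡ x ℕ.+ (y ℕ.+ z)
    id₁ = ℕ-Ring.solve-∀
    id₂ : ∀ x y z → x ℕ.+ (y ℕ.+ z) ≡ (y ℕ.+ x) ℕ.+ z
    id₂ = ℕ-Ring.solve-∀
  ... | no r+t≮q with ℕ.m≤n⇒∃[o]m+o≡n (ℕ.≮⇒≥ r+t≮q) | ℕ.m≤n⇒∃[o]m+o≡n (ℕ.m%n<n (N ℕ.* t ℕ.+ c) q)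
  -- `r′` is the remainder after the wrap-around and `e` = q - 1 - r. They satisfy e + 1 + r′ = t,
  -- which makes `e` a valid remainder modulo `t`.
  ...   | r′ , q+r′≡r+t | e , r+e+1≡q = inj₂
    ( proj₁ (/%-unique q r′ (suc (A N)) (ℕ.<-≤-trans r′<t t≤q) (begin
        t ℕ.+ N ℕ.* t ℕ.+ c               ≡⟨ id₁ t (N ℕ.* t) c ⟩
        t ℕ.+ (N ℕ.* t ℕ.+ c)             ≡⟨ cong (t ℕ.+_) divided ⟩
        t ℕ.+ (r ℕ.+ A N ℕ.* q)           ≡⟨ id₂ t r (A N ℕ.* q) ⟩
        (r ℕ.+ t) ℕ.+ A N ℕ.* q           ≡⟨ cong (ℕ._+ A N ℕ.* q) q+r′≡r+t ⟨
        (q ℕ.+ r′) ℕ.+ A N ℕ.* q          ≡⟨ id₃ q r′ (A N) ⟩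
        r′ ℕ.+ suc (A N) ℕ.* q            ∎))
    , proj₁ (/%-unique t e N e<t s+Aq≡))
    where
    r = (N ℕ.* t ℕ.+ c) ℕ.% q
    divided : N ℕ.* t ℕ.+ c ≡ r ℕ.+ A N ℕ.* q
    divided = ℕ.m≡m%n+[m/n]*n (N ℕ.* t ℕ.+ c) q
    id₁ : ∀ x y z → x ℕ.+ y ℕ.+ z ≡ x ℕ.+ (y ℕ.+ z)
    id₁ = ℕ-Ring.solve-∀
    id₂ : ∀ x y z → x ℕ.+ (y ℕ.+ z) ≡ (y ℕ.+ x) ℕ.+ z
    id₂ = ℕ-Ring.solve-∀
    id₃ : ∀ q r′ a → (q ℕ.+ r′) ℕ.+ a ℕ.* q ≡ r′ ℕ.+ suc a ℕ.* q
    id₃ = ℕ-Ring.solve-∀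
    r<q : r ℕ.< q
    r<q = ℕ.m%n<n (N ℕ.* t ℕ.+ c) q
    r′<t : r′ ℕ.< t
    r′<t = ℕ.+-cancelˡ-< q r′ t (subst (ℕ._< q ℕ.+ t) (sym q+r′≡r+t) (ℕ.+-monoˡ-< t r<q))
    e+1+r′≡t : suc e ℕ.+ r′ ≡ t
    e+1+r′≡t = ℕ.+-cancelˡ-≡ r _ _ (begin
      r ℕ.+ (suc e ℕ.+ r′)       ≡⟨ id₄ r e r′ ⟩
      suc (r ℕ.+ e) ℕ.+ r′       ≡⟨ cong (ℕ._+ r′) r+e+1≡q ⟩
      q ℕ.+ r′                   ≡⟨ q+r′≡r+t ⟩
      r ℕ.+ t                    ∎)
      where
      id₄ : ∀ r e r′ → r ℕ.+ (suc e ℕ.+ r′) ≡ suc (r ℕ.+ e) ℕ.+ r′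
      id₄ = ℕ-Ring.solve-∀
    e<t : e ℕ.< t
    e<t = subst (e ℕ.<_) e+1+r′≡t (ℕ.m≤m+n (suc e) r′)
    s+Aq≡ : s ℕ.+ A N ℕ.* q ≡ e ℕ.+ N ℕ.* t
    -- Adding r + c + 1 to both sides avoids subtraction: s + c + 1 and r + e + 1 both equal `q`.
    s+Aq≡ = ℕ.+-cancelʳ-≡ (suc (r ℕ.+ c)) _ _ (begin
      s ℕ.+ A N ℕ.* q ℕ.+ suc (r ℕ.+ c)           ≡⟨ id₄ s (A N ℕ.* q) r c ⟩
      (s ℕ.+ suc c) ℕ.+ (r ℕ.+ A N ℕ.* q)         ≡⟨ cong₂ ℕ._+_ (trans s+c+1≡q (sym r+e+1≡q)) (sym divided) ⟩
      suc (r ℕ.+ e) ℕ.+ (N ℕ.* t ℕ.+ c)           ≡⟨ id₅ r e (N ℕ.* t) c ⟩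
      e ℕ.+ N ℕ.* t ℕ.+ suc (r ℕ.+ c)             ∎)
      where
      id₄ : ∀ s x r c → s ℕ.+ x ℕ.+ suc (r ℕ.+ c) ≡ (s ℕ.+ suc c) ℕ.+ (r ℕ.+ x)
      id₄ = ℕ-Ring.solve-∀
      id₅ : ∀ r e x c → suc (r ℕ.+ e) ℕ.+ (x ℕ.+ c) ≡ e ℕ.+ x ℕ.+ suc (r ℕ.+ c)
      id₅ = ℕ-Ring.solve-∀
  go : ∀ N → ∑< (suc N) A ℕ.+ ∑< (A N) F ≡ N ℕ.* A N
  -- Column 0 is empty because c < q gives `A 0` = 0.
  go zero    rewrite ℕ.m<n⇒m/n≡0 c<q = refl
  go (suc N) with step N
  ... | inj₁ A≡ = begin
    ∑< (suc N) A ℕ.+ A (suc N) ℕ.+ ∑< (A (suc N)) F       ≡⟨ cong (λ a → ∑< (suc N) A ℕ.+ a ℕ.+ ∑< a F) A≡ ⟩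
    ∑< (suc N) A ℕ.+ A N ℕ.+ ∑< (A N) F                   ≡⟨ id₁ (∑< (suc N) A) (A N) (∑< (A N) F) ⟩
    A N ℕ.+ (∑< (suc N) A ℕ.+ ∑< (A N) F)                 ≡⟨ cong (A N ℕ.+_) (go N) ⟩
    suc N ℕ.* A N                                         ≡⟨ cong (suc N ℕ.*_) A≡ ⟨
    suc N ℕ.* A (suc N)                                   ∎
    where
    id₁ : ∀ x a y → x ℕ.+ a ℕ.+ y ≡ a ℕ.+ (x ℕ.+ y)
    id₁ = ℕ-Ring.solve-∀
  ... | inj₂ (A≡ , F≡) = begin
    ∑< (suc N) A ℕ.+ A (suc N) ℕ.+ ∑< (A (suc N)) F                   ≡⟨ cong (λ a → ∑< (suc N) A ℕ.+ a ℕ.+ ∑< a F) A≡ ⟩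
    ∑< (suc N) A ℕ.+ suc (A N) ℕ.+ (∑< (A N) F ℕ.+ F (A N))           ≡⟨ cong (λ f → ∑< (suc N) A ℕ.+ suc (A N) ℕ.+ (∑< (A N) F ℕ.+ f)) F≡ ⟩
    ∑< (suc N) A ℕ.+ suc (A N) ℕ.+ (∑< (A N) F ℕ.+ N)                 ≡⟨ id₁ (∑< (suc N) A) (A N) (∑< (A N) F) N ⟩
    (∑< (suc N) A ℕ.+ ∑< (A N) F) ℕ.+ (suc (A N) ℕ.+ N)               ≡⟨ cong (ℕ._+ (suc (A N) ℕ.+ N)) (go N) ⟩
    N ℕ.* A N ℕ.+ (suc (A N) ℕ.+ N)                                   ≡⟨ id₂ N (A N) ⟩
    suc N ℕ.* suc (A N)                                               ≡⟨ cong (suc N ℕ.*_) A≡ ⟨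
    suc N ℕ.* A (suc N)                                               ∎
    where
    id₁ : ∀ x a y n → x ℕ.+ suc a ℕ.+ (y ℕ.+ n) ≡ (x ℕ.+ y) ℕ.+ (suc a ℕ.+ n)
    id₁ = ℕ-Ring.solve-∀
    id₂ : ∀ n a → n ℕ.* a ℕ.+ (suc a ℕ.+ n) ≡ suc n ℕ.* suc a
    id₂ = ℕ-Ring.solve-∀

-- Sequences with increments Q + ε (m + 1)

module _ (F ε : ℕ → ℕ) (Q : ℕ) (F-step : ∀ m → F (suc m) ≡ F m ℕ.+ Q ℕ.+ ε (suc m)) where

  telescope : ∀ n → F n ≡ F 0 ℕ.+ n ℕ.* Q ℕ.+ ∑< n (ε ∘ suc)
  telescope zero    = sym (trans (ℕ.+-identityʳ _) (ℕ.+-identityʳ _))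
  telescope (suc n) rewrite F-step n | telescope n = lemma (F 0) n Q (∑< n (ε ∘ suc)) (ε (suc n))
    where
    lemma : ∀ f n Q x e → f ℕ.+ n ℕ.* Q ℕ.+ x ℕ.+ Q ℕ.+ e ≡ f ℕ.+ (Q ℕ.+ n ℕ.* Q) ℕ.+ (x ℕ.+ e)
    lemma = ℕ-Ring.solve-∀

  -- Summation by parts: (n + 1) F n minus the sum of `F` is the sum of k (F k - F (k - 1)), and
  -- each increment is Q + ε k. The index k = 0 has weight 0.
  abel : ∀ n → suc n ℕ.* F n ≡ Q ℕ.* ∑< (suc n) id ℕ.+ ∑< (suc n) (λ k → k ℕ.* ε k) ℕ.+ ∑< (suc n) F
  abel zero    = lemma (F 0) Q
    where
    lemma : ∀ f Q → f ℕ.+ 0 ≡ Q ℕ.* 0 ℕ.+ 0 ℕ.+ f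
    lemma = ℕ-Ring.solve-∀
  abel (suc n) = begin
    suc (suc n) ℕ.* F (suc n)                                  ≡⟨ cong (λ f → F (suc n) ℕ.+ suc n ℕ.* f) (F-step n) ⟩
    F (suc n) ℕ.+ suc n ℕ.* (F n ℕ.+ Q ℕ.+ ε (suc n))          ≡⟨ id₁ (F (suc n)) (suc n) (F n) Q (ε (suc n)) ⟩
    suc n ℕ.* F n ℕ.+ rest                                     ≡⟨ cong (ℕ._+ rest) (abel n) ⟩
    (Q ℕ.* T ℕ.+ W ℕ.+ Σ) ℕ.+ rest                             ≡⟨ id₂ Q T W Σ (F (suc n)) (suc n) (ε (suc n)) ⟩
    Q ℕ.* (T ℕ.+ suc n) ℕ.+ (W ℕ.+ suc n ℕ.* ε (suc n)) ℕ.+ (Σ ℕ.+ F (suc n)) ∎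
    where
    open ≡-Reasoning
    T = ∑< (suc n) id
    W = ∑< (suc n) (λ k → k ℕ.* ε k)
    Σ = ∑< (suc n) F
    rest = F (suc n) ℕ.+ suc n ℕ.* Q ℕ.+ suc n ℕ.* ε (suc n)
    id₁ : ∀ f′ n f Q e → f′ ℕ.+ n ℕ.* (f ℕ.+ Q ℕ.+ e) ≡ n ℕ.* f ℕ.+ (f′ ℕ.+ n ℕ.* Q ℕ.+ n ℕ.* e)
    id₁ = ℕ-Ring.solve-∀
    id₂ : ∀ Q T W S f n e → (Q ℕ.* T ℕ.+ W ℕ.+ S) ℕ.+ (f ℕ.+ n ℕ.* Q ℕ.+ n ℕ.* e) ≡ Q ℕ.* (T ℕ.+ n) ℕ.+ (W ℕ.+ n ℕ.* e) ℕ.+ (S ℕ.+ f)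
    id₂ = ℕ-Ring.solve-∀

-- Sums of periodic sequences

module _ (ε : ℕ → ℕ) (p : ℕ) (periodic : ∀ u k → ε (u ℕ.* p ℕ.+ k) ≡ ε k) where

  -- The increments of `F` involve `ε` at 1, ..., p, whereas `J` counts it at 0, ..., p - 1; the two
  -- ends agree by periodicity.
  ∑<-period-shift : ∑< p (ε ∘ suc) ≡ ∑< p ε
  ∑<-period-shift = ℕ.+-cancelˡ-≡ (ε 0) _ _ (begin
    ε 0 ℕ.+ ∑< p (ε ∘ suc)       ≡⟨ ∑<-split 1 p ε ⟨
    ∑< p ε ℕ.+ ε p               ≡⟨ cong (∑< p ε ℕ.+_) (trans (cong ε p≡) (periodic 1 0)) ⟩
    ∑< p ε ℕ.+ ε 0               ≡⟨ ℕ.+-comm (∑< p ε) (ε 0) ⟩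
    ε 0 ℕ.+ ∑< p ε               ∎)
    where
    open ≡-Reasoning
    p≡ : p ≡ 1 ℕ.* p ℕ.+ 0
    p≡ = sym (trans (ℕ.+-identityʳ _) (ℕ.*-identityˡ p))

  -- The block that starts at u p repeats the first block with all weights raised by u p. These
  -- excesses add up to p times the sum of `ε` over one period times 0 + ... + (u - 1).
  ∑<-periods : ∀ u → ∑< (u ℕ.* p) (λ k → k ℕ.* ε k) ≡ u ℕ.* ∑< p (λ k → k ℕ.* ε k) ℕ.+ ∑< p ε ℕ.* p ℕ.* ∑< u id
  ∑<-periods zero    = sym (ℕ.*-zeroʳ (∑< p ε ℕ.* p))
  ∑<-periods (suc u) = begin
    ∑< (p ℕ.+ u ℕ.* p) w                                          ≡⟨ cong (λ n → ∑< n w) (ℕ.+-comm p (u ℕ.* p)) ⟩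
    ∑< (u ℕ.* p ℕ.+ p) w                                          ≡⟨ ∑<-split (u ℕ.* p) p w ⟩
    ∑< (u ℕ.* p) w ℕ.+ ∑< p (λ k → w (u ℕ.* p ℕ.+ k))             ≡⟨ cong₂ ℕ._+_ (∑<-periods u) (trans
                                                                       (∑<-cong p λ k _ → cong ((u ℕ.* p ℕ.+ k) ℕ.*_) (periodic u k))
                                                                       (∑<-affine (u ℕ.* p) p ε)) ⟩
    (u ℕ.* W ℕ.+ C ℕ.* p ℕ.* T) ℕ.+ (u ℕ.* p ℕ.* C ℕ.+ W)         ≡⟨ lemma u W C p T ⟩
    suc u ℕ.* W ℕ.+ C ℕ.* p ℕ.* (T ℕ.+ u)                         ∎
    where
    open ≡-Reasoning
    w : ℕ → ℕ
    w k = k ℕ.* ε k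
    W = ∑< p w
    C = ∑< p ε
    T = ∑< u id
    lemma : ∀ u W C p T → (u ℕ.* W ℕ.+ C ℕ.* p ℕ.* T) ℕ.+ (u ℕ.* p ℕ.* C ℕ.+ W) ≡ (W ℕ.+ u ℕ.* W) ℕ.+ C ℕ.* p ℕ.* (T ℕ.+ u)
    lemma = ℕ-Ring.solve-∀

-- Carries modulo `t̃` and the set `H`

module _ (s t q N : ℕ) .{{_ : NonZero t}} .{{_ : NonZero q}} (t∤q : t ∤ q) where

  open Setting s t q N t∤q

  private
    -- For s < q, `A k` is the ceiling of (k t - s)/q, that is, the negated summand of `S⁻`.
    ε w F A : ℕ → ℕ
    ε k = ⟦ H? k ⟧
    w k = k ℕ.* ε k
    F m = (s ℕ.+ m ℕ.* q) ℕ./ t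
    A k = (k ℕ.* t ℕ.+ (q ℕ.∸ suc s)) ℕ./ q

    Q : ℕ
    Q = q ℕ./ t

    g*t̃≡t : g ℕ.* t̃ ≡ t
    g*t̃≡t = ℕ.m*[n/m]≡n (gcd[m,n]∣m t q)

    /t≡/g/t̃ : ∀ m → m ℕ./ t ≡ m ℕ./ g ℕ./ t̃
    /t≡/g/t̃ m = sym (trans (ℕ.m/n/o≡m/[n*o] m g t̃) (ℕ./-congʳ g*t̃≡t))
      where instance g*t̃≢0 = ℕ.m*n≢0 g t̃

    -- Since `g` divides both `t` and m q, dividing by `g` first only drops s mod g, which cannot
    -- change the floor.
    F≡ : ∀ m → F m ≡ (s̄ ℕ.+ m ℕ.* q̃) ℕ./ t̃
    F≡ m = begin
      (s ℕ.+ m ℕ.* q) ℕ./ t                     ≡⟨ /t≡/g/t̃ (s ℕ.+ m ℕ.* q) ⟩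
      (s ℕ.+ m ℕ.* q) ℕ./ g ℕ./ t̃               ≡⟨ cong (ℕ._/ t̃) (ℕ.+-distrib-/-∣ʳ s (∣n⇒∣m*n m (gcd[m,n]∣n t q))) ⟩
      (s̄ ℕ.+ m ℕ.* q ℕ./ g) ℕ./ t̃               ≡⟨ cong (λ x → (s̄ ℕ.+ x) ℕ./ t̃) (ℕ.*-/-assoc m (gcd[m,n]∣n t q)) ⟩
      (s̄ ℕ.+ m ℕ.* q̃) ℕ./ t̃                     ∎
      where open ≡-Reasoning

    -- The carry is read off the remainder after `q̃` has been added, hence `ε` at `suc m`.
    F-step : ∀ m → F (suc m) ≡ F m ℕ.+ Q ℕ.+ ε (suc m)
    F-step m = begin
      F (suc m)                                                          ≡⟨ F≡ (suc m) ⟩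
      (s̄ ℕ.+ (q̃ ℕ.+ m ℕ.* q̃)) ℕ./ t̃                                      ≡⟨ cong (ℕ._/ t̃) next ⟩
      (x ℕ.+ q̃) ℕ./ t̃                                                    ≡⟨ /-+-carry x q̃ t̃ ⟩
      x ℕ./ t̃ ℕ.+ q̃ ℕ./ t̃ ℕ.+ ⟦ (x ℕ.+ q̃) ℕ.% t̃ ℕ.<? q̂ ⟧                 ≡⟨ cong₂ ℕ._+_ (cong₂ ℕ._+_ (sym (F≡ m)) (sym (/t≡/g/t̃ q)))
                                                                              (cong (λ r → ⟦ r ℕ.<? q̂ ⟧) (sym remainder)) ⟩
      F m ℕ.+ Q ℕ.+ ε (suc m)                                            ∎
      where
      open ≡-Reasoning
      x = s̄ ℕ.+ m ℕ.* q̃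
      next : s̄ ℕ.+ (q̃ ℕ.+ m ℕ.* q̃) ≡ x ℕ.+ q̃
      next = trans (cong (s̄ ℕ.+_) (ℕ.+-comm q̃ (m ℕ.* q̃))) (sym (ℕ.+-assoc s̄ (m ℕ.* q̃) q̃))
      remainder : (ŝ ℕ.+ suc m ℕ.* q̂) ℕ.% t̃ ≡ (x ℕ.+ q̃) ℕ.% t̃
      remainder = trans (%-affine s̄ q̃ (suc m) t̃) (cong (ℕ._% t̃) next)

    remainder-periodic : ∀ u k → (ŝ ℕ.+ (u ℕ.* t̃ ℕ.+ k) ℕ.* q̂) ℕ.% t̃ ≡ (ŝ ℕ.+ k ℕ.* q̂) ℕ.% t̃
    remainder-periodic u k = trans (cong (ℕ._% t̃) (lemma ŝ u t̃ k q̂)) (ℕ.[m+kn]%n≡m%n (ŝ ℕ.+ k ℕ.* q̂) (u ℕ.* q̂) t̃)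
      where
      lemma : ∀ s u t k q → s ℕ.+ (u ℕ.* t ℕ.+ k) ℕ.* q ≡ s ℕ.+ k ℕ.* q ℕ.+ u ℕ.* q ℕ.* t
      lemma = ℕ-Ring.solve-∀

    ε-periodic : ∀ u k → ε (u ℕ.* t̃ ℕ.+ k) ≡ ε k
    ε-periodic u k = cong (λ r → ⟦ r ℕ.<? q̂ ⟧) (remainder-periodic u k)

    H-unshift : ∀ u k → H (u ℕ.* t̃ ℕ.+ k) → H k
    H-unshift u k = subst (ℕ._< q̂) (remainder-periodic u k)

    -- Over one period, F grows by q̃ = Q t̃ + q̂, so that q̂ of its steps are carries.
    ∑ε≡q̂ : ∑< t̃ ε ≡ q̂
    ∑ε≡q̂ = trans (sym (∑<-period-shift ε t̃ ε-periodic)) (ℕ.+-cancelˡ-≡ (F 0 ℕ.+ t̃ ℕ.* Q) _ _ (begin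
      F 0 ℕ.+ t̃ ℕ.* Q ℕ.+ ∑< t̃ (ε ∘ suc)       ≡⟨ telescope F ε Q F-step t̃ ⟨
      F t̃                                      ≡⟨ F≡ t̃ ⟩
      (s̄ ℕ.+ t̃ ℕ.* q̃) ℕ./ t̃                    ≡⟨ ℕ.+-distrib-/-∣ʳ s̄ (divides q̃ (ℕ.*-comm t̃ q̃)) ⟩
      s̄ ℕ./ t̃ ℕ.+ t̃ ℕ.* q̃ ℕ./ t̃                ≡⟨ cong₂ ℕ._+_ (trans (cong (ℕ._/ t̃) (sym (ℕ.+-identityʳ s̄))) (sym (F≡ 0)))
                                                  (trans (cong (ℕ._/ t̃) (ℕ.*-comm t̃ q̃)) (ℕ.m*n/n≡m q̃ t̃)) ⟩
      F 0 ℕ.+ q̃                                ≡⟨ cong (F 0 ℕ.+_) (ℕ.m≡m%n+[m/n]*n q̃ t̃) ⟩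
      F 0 ℕ.+ (q̂ ℕ.+ q̃ ℕ./ t̃ ℕ.* t̃)            ≡⟨ cong (λ x → F 0 ℕ.+ (q̂ ℕ.+ x ℕ.* t̃)) (/t≡/g/t̃ q) ⟨
      F 0 ℕ.+ (q̂ ℕ.+ Q ℕ.* t̃)                  ≡⟨ lemma (F 0) q̂ Q t̃ ⟩
      F 0 ℕ.+ t̃ ℕ.* Q ℕ.+ q̂                    ∎))
      where
      open ≡-Reasoning
      lemma : ∀ f q Q t → f ℕ.+ (q ℕ.+ Q ℕ.* t) ≡ f ℕ.+ t ℕ.* Q ℕ.+ q
      lemma = ℕ-Ring.solve-∀

    H∩? : ∀ a b k → Dec ((a ≤ + k) × (+ k ≤ b) × H k)
    H∩? a b k = (a ℤ.≤? + k) ×-dec (+ k ℤ.≤? b) ×-dec H? k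

    ⟦H∩?⟧ : ∀ a b k → a ℕ.≤ k → k ℕ.≤ b → ⟦ H∩? (+ a) (+ b) k ⟧ ≡ ε k
    ⟦H∩?⟧ a b k a≤k k≤b = ⟦⟧-cong (H∩? (+ a) (+ b) k) (H? k)
      (proj₂ ∘ proj₂) (λ h → ℤ.+≤+ a≤k , ℤ.+≤+ k≤b , h)

    -- Written as a completion of the sum below `a`, to avoid subtraction. Taking a = 0 gives
    -- initial segments such as `J`; taking a = u t̃ gives the tail beyond the full periods.
    sum-H∩ : ∀ a n → a ℕ.≤ n → ∑< a w ℕ.+ sum H∩[ + a ⋯ + n - 1ℤ ] ≡ ∑< n w
    -- The upper bound is -1 here, so the candidates are 0 and 1, and the filter rejects both.
    sum-H∩ zero zero    a≤n = refl
    sum-H∩ a    (suc b) a≤n with ℕ.m≤n⇒∃[o]m+o≡n a≤n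
    ... | o , a+o≡n = begin
      ∑< a w ℕ.+ sum H∩[ + a ⋯ + b ]                          ≡⟨ cong (∑< a w ℕ.+_) (sum-filter-upTo (H∩? (+ a) (+ b)) (suc b)) ⟩
      ∑< a w ℕ.+ ∑< (suc b) f                                 ≡⟨ cong (λ n → ∑< a w ℕ.+ ∑< n f) a+o≡n ⟨
      ∑< a w ℕ.+ ∑< (a ℕ.+ o) f                               ≡⟨ cong (∑< a w ℕ.+_) (∑<-split a o f) ⟩
      ∑< a w ℕ.+ (∑< a f ℕ.+ ∑< o (λ k → f (a ℕ.+ k)))        ≡⟨ cong₂ (λ x y → ∑< a w ℕ.+ (x ℕ.+ y)) (∑<-zero a below) (∑<-cong o above) ⟩
      ∑< a w ℕ.+ ∑< o (λ k → w (a ℕ.+ k))                     ≡⟨ ∑<-split a o w ⟨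
      ∑< (a ℕ.+ o) w                                          ≡⟨ cong (λ n → ∑< n w) a+o≡n ⟩
      ∑< (suc b) w                                            ∎
      where
      open ≡-Reasoning
      f : ℕ → ℕ
      f k = k ℕ.* ⟦ H∩? (+ a) (+ b) k ⟧
      below : ∀ k → k ℕ.< a → f k ≡ 0
      below k k<a = trans
        (cong (k ℕ.*_) (⟦⟧-no (H∩? (+ a) (+ b) k) λ (a≤k , _) → ℕ.<⇒≱ k<a (ℤ.drop‿+≤+ a≤k)))
        (ℕ.*-zeroʳ k)
      above : ∀ k → k ℕ.< o → f (a ℕ.+ k) ≡ w (a ℕ.+ k)
      above k k<o = cong ((a ℕ.+ k) ℕ.*_) (⟦H∩?⟧ a b (a ℕ.+ k) (ℕ.m≤m+n a k)
        (ℕ.s≤s⁻¹ (subst (a ℕ.+ k ℕ.<_) a+o≡n (ℕ.+-monoʳ-< a k<o))))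

    length-H∩ : ∀ n → length H∩[ 0ℤ ⋯ + n - 1ℤ ] ≡ ∑< n ε
    length-H∩ zero    = refl
    length-H∩ (suc b) = trans (length-filter-upTo (H∩? 0ℤ (+ b)) (suc b))
      (∑<-cong (suc b) λ k k≤b → ⟦H∩?⟧ 0 b k ℕ.z≤n (ℕ.s≤s⁻¹ k≤b))

    ∈-H∩ : ∀ n {k} → k ℕ.< n → H k → k ∈ H∩[ 0ℤ ⋯ + n - 1ℤ ]
    ∈-H∩ (suc b) k<n h = ∈-filter⁺ (H∩? 0ℤ (+ b)) (∈-upTo⁺ k<n) (ℤ.+≤+ ℕ.z≤n , ℤ.+≤+ (ℕ.s≤s⁻¹ k<n) , h)

    ¬H⇒w≡0 : ∀ k → ¬ H k → w k ≡ 0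
    ¬H⇒w≡0 k ¬h = trans (cong (k ℕ.*_) (⟦⟧-no (H? k) ¬h)) (ℕ.*-zeroʳ k)

  -- A filtered `upTo` is increasing, and its length is the number of carries in one period, namely
  -- `q̂`.
  J-enumerable : ∃[ j ] EnumeratesJ j
  J-enumerable = increasing-tabulate
    (AllPairs.filter⁺ (H∩? 0ℤ (+ t̃ - 1ℤ)) (AllPairs.applyUpTo⁺₁ id (suc ℤ.∣ + t̃ - 1ℤ ∣) λ i<j _ → i<j))
    (trans (length-H∩ t̃) ∑ε≡q̂)

  -- Bounds on `H` from the first and last elements of `J`

  module _ {j : Fin q̂ → ℕ} (enum : EnumeratesJ j) where

    private
      index : ∀ {k} → k ℕ.< t̃ → H k → ∃[ i ] k ≡ j i
      index {k} k<t̃ h = ∈-tabulate⁻ (subst (k ∈_) (proj₂ enum) (∈-H∩ t̃ k<t̃ h))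

      j-mono : ∀ {i i′} → i Fin.≤ i′ → j i ℕ.≤ j i′
      j-mono {i} {i′} i≤i′ with ℕ.m≤n⇒m<n∨m≡n i≤i′
      ... | inj₁ i<i′ = ℕ.<⇒≤ (proj₁ enum i<i′)
      ... | inj₂ i≡i′ = ℕ.≤-reflexive (cong j (Fin.toℕ-injective i≡i′))

    -- The bound covers all of `H`: reducing `k` modulo `t̃` stays in `H` by periodicity, lands in
    -- `J`, and does not increase `k`.
    j-first≤ : ∀ k → H k → j first ℕ.≤ k
    j-first≤ k h = let i , k%t̃≡ji = index (ℕ.m%n<n k t̃) (H-unshift (k ℕ./ t̃) (k ℕ.% t̃) (subst H k≡ h)) in begin
      j first       ≤⟨ j-mono (ℕ.≤-trans (ℕ.≤-reflexive (Fin.toℕ-fromℕ< _)) ℕ.z≤n) ⟩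
      j i           ≡⟨ k%t̃≡ji ⟨
      k ℕ.% t̃       ≤⟨ ℕ.m%n≤m k t̃ ⟩
      k             ∎
      where
      open ℕ.≤-Reasoning
      k≡ : k ≡ k ℕ./ t̃ ℕ.* t̃ ℕ.+ k ℕ.% t̃
      k≡ = trans (ℕ.m≡m%n+[m/n]*n k t̃) (ℕ.+-comm (k ℕ.% t̃) _)

    j-first+t̃≤ : ∀ k → t̃ ℕ.≤ k → H k → j first ℕ.+ t̃ ℕ.≤ k
    j-first+t̃≤ k t̃≤k h = subst (j first ℕ.+ t̃ ℕ.≤_) (ℕ.m∸n+n≡m t̃≤k) (ℕ.+-monoˡ-≤ t̃
      (j-first≤ (k ℕ.∸ t̃) (H-unshift 1 (k ℕ.∸ t̃) (subst H k≡ h))))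
      where
      k≡ : k ≡ 1 ℕ.* t̃ ℕ.+ (k ℕ.∸ t̃)
      k≡ = sym (trans (cong (ℕ._+ (k ℕ.∸ t̃)) (ℕ.*-identityˡ t̃)) (ℕ.m+[n∸m]≡n t̃≤k))

    ≤j-last : ∀ k → k ℕ.< t̃ → H k → k ℕ.≤ j last
    ≤j-last k k<t̃ h with index k<t̃ h
    ... | i , refl = j-mono (subst (Fin.toℕ i ℕ.≤_) (sym (Fin.toℕ-fromℕ< _)) (ℕ.<⇒≤pred (Fin.toℕ<n i)))

  -- Evaluation of `S⁻` and the four cases

  module _ (s<q : s ℕ.< q) (t<q : t ℕ.< q) where

    private
      c : ℕ
      c = q ℕ.∸ suc s

      s+c+1≡q : s ℕ.+ suc c ≡ q
      s+c+1≡q = trans (ℕ.+-suc s c) (ℕ.m+[n∸m]≡n s<q)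

      ⌊⌋≡-A : ∀ k → floor ((+ s - + k * + t) ℚ./ q) ≡ - + A k
      ⌊⌋≡-A k = trans (cong (λ x → floor ((+ s - x) ℚ./ q)) (sym (ℤ.pos-* k t))) (floor-neg s c (k ℕ.* t) q s+c+1≡q)

      M≡ : M ≡ + A N
      M≡ = trans (cong -_ (⌊⌋≡-A N)) (ℤ.neg-involutive (+ A N))

      S⁻≡ : S⁻ s t q N ≡ - + ∑< (suc N) A
      S⁻≡ = foldr-+-neg (suc N) ⌊⌋≡-A

      -- For positive `a` the floor is F (a - 1), so this is `abel` at a - 1. For a = 0 the floor is
      -- multiplied by 0.
      M*⌊x-M⌋ : ∀ a → + a * floor ((+ s + (+ a - 1ℤ) * + q) ℚ./ t) ≡ + Q * + ∑< a id + + ∑< a w + + ∑< a F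
      M*⌊x-M⌋ zero    = trans (ℤ.*-zeroˡ (floor ((+ s + (0ℤ - 1ℤ) * + q) ℚ./ t))) (sym (cong (λ x → x + 0ℤ + 0ℤ) (ℤ.*-zeroʳ (+ Q))))
      M*⌊x-M⌋ (suc n) = begin
        + suc n * floor ((+ s + + n * + q) ℚ./ t)            ≡⟨ cong (λ x → + suc n * floor ((+ s + x) ℚ./ t)) (ℤ.pos-* n q) ⟨
        + suc n * floor (+ (s ℕ.+ n ℕ.* q) ℚ./ t)            ≡⟨ cong (+ suc n *_) (floor-+ (s ℕ.+ n ℕ.* q) t) ⟩
        + suc n * + F n                                      ≡⟨ ℤ.pos-* (suc n) (F n) ⟨
        + (suc n ℕ.* F n)                                    ≡⟨ cong +_ (abel F ε Q F-step n) ⟩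
        + (Q ℕ.* ∑< (suc n) id) + + ∑< (suc n) w + + ∑< (suc n) F
                                                             ≡⟨ cong (λ x → x + + ∑< (suc n) w + + ∑< (suc n) F) (ℤ.pos-* Q (∑< (suc n) id)) ⟩
        + Q * + ∑< (suc n) id + + ∑< (suc n) w + + ∑< (suc n) F ∎
        where open ≡-Reasoning

    -- Counting by rows expresses `S⁻` as the sum of `F` minus N M; summation by parts trades that
    -- sum for M ⌊x_M⌋, the triangular term and the sum over `H`.
    S⁻≡S-∑ : S⁻ s t q N ≡ S - + ∑< (A N) w
    S⁻≡S-∑ = begin
      S⁻ s t q N                                                   ≡⟨ S⁻≡ ⟩
      - + ΣA                                                       ≡⟨ id₁ (+ ΣA) (+ ΣF) ⟩
      + ΣF - + (ΣA ℕ.+ ΣF)                                         ≡⟨ cong (λ x → + ΣF - x) (trans (cong +_ (∑⌈⌉+∑⌊⌋ s c t q s+c+1≡q (ℕ.<⇒≤ t<q) N)) (ℤ.pos-* N a)) ⟩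
      -- The triangular term and `W` are added and subtracted to complete `ΣF` to the right-hand
      -- side of `M*⌊x-M⌋`.
      + ΣF - + N * + a                                             ≡⟨ id₂ (+ Q * + ∑< a id) (+ W) (+ ΣF) (+ N) (+ a) ⟩
      - (+ Q * + ∑< a id) - + a * + N + (+ Q * + ∑< a id + + W + + ΣF) - + W
                                                                   ≡⟨ cong (λ x → - (+ Q * + ∑< a id) - + a * + N + x - + W) (M*⌊x-M⌋ a) ⟨
      - (+ Q * + ∑< a id) - + a * + N + + a * x - + W              ≡⟨ id₃ (+ Q * + ∑< a id) (+ a) (+ N) x (+ W) ⟩
      - (+ Q * + ∑< a id) - + a * (+ N - x) - + W                  ≡⟨ cong₂ (λ y z → - (y * z) - + a * (+ N - x) - + W) (floor-+ q t) ([n-1]n/2≡∑< a) ⟨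
      S-at (+ a) - + W                                             ≡⟨ cong (λ m → S-at m - + W) M≡ ⟨
      S - + W                                                      ∎
      where
      open ≡-Reasoning
      a = A N
      ΣA = ∑< (suc N) A
      ΣF = ∑< a F
      W = ∑< a w
      x = floor ((+ s + (+ a - 1ℤ) * + q) ℚ./ t)
      -- `S` as a function of `M`, so that `M≡` is substituted at all occurrences at once.
      S-at : ℤ → ℤ
      S-at m = - (floor (+ q ℚ./ t) * (((m - 1ℤ) * m) /ℕ 2)) - m * (+ N - floor ((+ s + (m - 1ℤ) * + q) ℚ./ t))
      id₁ : ∀ x y → - x ≡ y - (x + y)
      id₁ = ℤ-Ring.solve-∀
      id₂ : ∀ k w f n a → f - n * a ≡ - k - a * n + (k + w + f) - w
      id₂ = ℤ-Ring.solve-∀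
      id₃ : ∀ k a n x w → - k - a * n + a * x - w ≡ - k - a * (n - x) - w
      id₃ = ℤ-Ring.solve-∀

    S⁻≡S-∑H : S⁻ s t q N ≡ S - ∑ H∩[ 0ℤ ⋯ M - 1ℤ ]
    S⁻≡S-∑H = trans S⁻≡S-∑ (cong (λ x → S - x) (trans (cong +_ (sym (sum-H∩ 0 (A N) ℕ.z≤n))) (cong (λ m → ∑ H∩[ 0ℤ ⋯ m - 1ℤ ]) (sym M≡))))

    S⁻≡S : ∀ {j} → EnumeratesJ j → + j first ≥ M → S⁻ s t q N ≡ S
    S⁻≡S {j} enum M≤j₀ = trans S⁻≡S-∑ (trans (cong (λ x → S - + x) W≡0) (ℤ.+-identityʳ S))
      where
      A≤j₀ : A N ℕ.≤ j first
      A≤j₀ = ℤ.drop‿+≤+ (subst (_≤ + j first) M≡ M≤j₀)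
      W≡0 : ∑< (A N) w ≡ 0
      W≡0 = ∑<-zero (A N) λ k k<A → ¬H⇒w≡0 k λ h → ℕ.<⇒≱ k<A (ℕ.≤-trans A≤j₀ (j-first≤ enum k h))

    -- `H` has no elements between `M` and `t̃`, in either order: if M ≤ t̃, all of `J` lies below
    -- `M`; if t̃ ≤ M, the next element of `H` is at least j first + t̃ ≥ M.
    S⁻≡S-∑J : ∀ {j} → EnumeratesJ j → + j last < M → + j first + + t̃ ≥ M → S⁻ s t q N ≡ S - ∑ J
    S⁻≡S-∑J {j} enum jₗ<M M≤j₀+t̃ = trans S⁻≡S-∑ (cong (λ x → S - + x) (trans W≡ (sym (sum-H∩ 0 t̃ ℕ.z≤n))))
      where
      jₗ<A : j last ℕ.< A N
      jₗ<A = ℤ.drop‿+<+ (subst (+ j last <_) M≡ jₗ<M)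
      A≤j₀+t̃ : A N ℕ.≤ j first ℕ.+ t̃
      A≤j₀+t̃ = ℤ.drop‿+≤+ (subst (_≤ + j first + + t̃) M≡ M≤j₀+t̃)
      W≡ : ∑< (A N) w ≡ ∑< t̃ w
      W≡ with ℕ.≤-total (A N) t̃
      ... | inj₁ A≤t̃ = sym (∑<-truncate A≤t̃ λ k A≤k k<t̃ →
        ¬H⇒w≡0 k λ h → ℕ.<⇒≱ jₗ<A (ℕ.≤-trans A≤k (≤j-last enum k k<t̃ h)))
      ... | inj₂ t̃≤A = ∑<-truncate t̃≤A λ k t̃≤k k<A →
        ¬H⇒w≡0 k λ h → ℕ.<⇒≱ k<A (ℕ.≤-trans A≤j₀+t̃ (j-first+t̃≤ enum k t̃≤k h))

    -- The range below `M` consists of `u` full periods, summed by `∑<-periods`, and the tail from u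
    -- t̃ to M - 1.
    S⁻≡S-periods : 0ℤ < M → S⁻ s t q N ≡
      S - u * ∑ J - + q̂ * + t̃ * (((u - 1ℤ) * u) /ℕ 2) - ∑ H∩[ u * + t̃ ⋯ M - 1ℤ ]
    S⁻≡S-periods 0<M = go (A N) refl M≡
      where
      open ≡-Reasoning
      rhs : ℤ → ℤ
      rhs v = S - v * ∑ J - + q̂ * + t̃ * (((v - 1ℤ) * v) /ℕ 2) - ∑ H∩[ v * + t̃ ⋯ M - 1ℤ ]
      -- Positivity of `M` excludes a = 0, so M - 1 is a natural `n` and `u` is the natural quotient
      -- of `n` by `t̃`.
      go : ∀ a → A N ≡ a → M ≡ + a → S⁻ s t q N ≡ rhs u
      go zero    A≡ M≡0   = contradiction (subst (0ℤ <_) M≡0 0<M) (ℤ.<-irrefl refl)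
      go (suc n) A≡ M≡1+n = begin
        S⁻ s t q N                                                            ≡⟨ S⁻≡S-∑ ⟩
        S - + ∑< (A N) w                                                      ≡⟨ cong (λ a → S - + ∑< a w) A≡ ⟩
        S - + ∑< (suc n) w                                                    ≡⟨ cong (λ x → S - + x) (sum-H∩ (U ℕ.* t̃) (suc n) Ut̃≤) ⟨
        S - (+ ∑< (U ℕ.* t̃) w + ∑K)                                           ≡⟨ cong (λ x → S - (x + ∑K)) periods ⟩
        S - ((+ U * ∑ J + + q̂ * + t̃ * + T) + ∑K)                              ≡⟨ rearrange S (+ U * ∑ J) (+ q̂ * + t̃ * + T) ∑K ⟩
        S - + U * ∑ J - + q̂ * + t̃ * + T - ∑K                                  ≡⟨ cong (λ x → S - + U * ∑ J - + q̂ * + t̃ * x - ∑K) ([n-1]n/2≡∑< U) ⟨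
        S - + U * ∑ J - + q̂ * + t̃ * (((+ U - 1ℤ) * + U) /ℕ 2) - ∑K            ≡⟨ cong (λ x → S - + U * ∑ J - + q̂ * + t̃ * (((+ U - 1ℤ) * + U) /ℕ 2) - x)
                                                                                 (cong₂ (λ x m → ∑ H∩[ x ⋯ m - 1ℤ ]) (ℤ.pos-* U t̃) (sym M≡1+n)) ⟩
        rhs (+ U)                                                             ≡⟨ cong rhs u≡ ⟨
        rhs u                                                                 ∎
        where
        U T : ℕ
        U = n ℕ./ t̃
        T = ∑< U id
        ∑K : ℤ
        ∑K = ∑ H∩[ + (U ℕ.* t̃) ⋯ + suc n - 1ℤ ]
        u≡ : u ≡ + U
        u≡ = trans (cong (λ m → floor ((m - 1ℤ) ℚ./ t̃)) M≡1+n) (floor-+ n t̃)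
        Ut̃≤ : U ℕ.* t̃ ℕ.≤ suc n
        Ut̃≤ = ℕ.m≤n⇒m≤1+n (ℕ.m/n*n≤m n t̃)
        periods : + ∑< (U ℕ.* t̃) w ≡ + U * ∑ J + + q̂ * + t̃ * + T
        periods = begin
          + ∑< (U ℕ.* t̃) w                                       ≡⟨ cong +_ (∑<-periods ε t̃ ε-periodic U) ⟩
          + (U ℕ.* ∑< t̃ w ℕ.+ ∑< t̃ ε ℕ.* t̃ ℕ.* T)                ≡⟨ cong₂ (λ x y → + (U ℕ.* x ℕ.+ y ℕ.* t̃ ℕ.* T)) (sym (sum-H∩ 0 t̃ ℕ.z≤n)) ∑ε≡q̂ ⟩
          + (U ℕ.* sum J) + + (q̂ ℕ.* t̃ ℕ.* T)                    ≡⟨ cong₂ _+_ (ℤ.pos-* U (sum J)) (trans (ℤ.pos-* (q̂ ℕ.* t̃) T) (cong (_* + T) (ℤ.pos-* q̂ t̃))) ⟩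
          + U * ∑ J + + q̂ * + t̃ * + T                            ∎
        rearrange : ∀ s x y z → s - ((x + y) + z) ≡ s - x - y - z
        rearrange = ℤ-Ring.solve-∀

theorem13 :
  (s t q N : ℕ) .{{_ : NonZero t}} .{{_ : NonZero q}} →
  s ℕ.< q → t ℕ.< q → (t∤q : t ∤ q) → gcd t q ℕ.> 1 →
  let open Setting s t q N t∤q in
  (∃[ j ] EnumeratesJ j) ×
  (∀ j → EnumeratesJ j →
    let j-first = + j first
        j-last = + j last in
    (j-first ≥ M → S⁻ s t q N ≡ S) ×
    (j-first < M → M ≤ j-last →
      S⁻ s t q N ≡ S - ∑ H∩[ 0ℤ ⋯ M - 1ℤ ]) ×
    (j-last < M → j-first + + t̃ ≥ M →
      S⁻ s t q N ≡ S - ∑ J) ×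
    (j-last < M → j-first + + t̃ < M →
      S⁻ s t q N ≡
        S - u * ∑ J - + q̂ * + t̃ * (((u - 1ℤ) * u) /ℕ 2)
          - ∑ H∩[ u * + t̃ ⋯ M - 1ℤ ]))
theorem13 s t q N s<q t<q t∤q _ = J-enumerable s t q N t∤q , λ j enum →
  S⁻≡S s t q N t∤q s<q t<q enum ,
  (λ _ _ → S⁻≡S-∑H s t q N t∤q s<q t<q) ,
  S⁻≡S-∑J s t q N t∤q s<q t<q enum ,
  -- Positivity of `M` comes from 0 ≤ j last < M.
  (λ jₗ<M _ → S⁻≡S-periods s t q N t∤q s<q t<q (ℤ.≤-<-trans (ℤ.+≤+ ℕ.z≤n) jₗ<M))
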